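{- Let $P(7,1)$ be the graph with vertex set $\{u_0,\dots,u_6,v_0,\dots,v_6\}$ and edges $u_iu_{i+1}$, $v_iv_{i+1}$, $u_iv_i$ ($i=0,\dots,6$, indices mod $7$). Every matching of $P(7,1)$ of size five, regarded as a signature, is switching equivalent to a matching of $P(7,1)$ of size at most $4$.
   Context: A matching of size $k$ is a set of $k$ pairwise vertex-disjoint edges. A signature of a graph $G$ is a subset $\Sigma\subseteq E(G)$ (the negative edges). Resigning at a vertex $v$ replaces $\Sigma$ by its symmetric difference with the set of edges incident with $v$; two signatures are switching equivalent if one is obtained from the other by a sequence of resignings. -}

module Defs where

open import Data.Nat using (ℕ; _≤_)
open import Data.Fin using (Fin; zero; suc; _≟_)
open import Data.Bool using (Bool; true; false; if_then_else_; _xor_)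
open import Data.List using (List; _++_; map)
open import Data.Nat.ListAction using (sum)
open import Data.List using () renaming (allFin to allFinL)
open import Data.Product using (_×_; _,_; proj₁; proj₂)
open import Data.Empty using (⊥)
open import Relation.Nullary using (¬_; Dec; yes; no)
open import Relation.Nullary.Decidable using (⌊_⌋)
open import Relation.Binary.PropositionalEquality using (_≡_; _≢_; refl; cong)
open import Relation.Binary.Construct.Closure.ReflexiveTransitive using (Star)

data Vertex : Set where
  u : Fin 7 → Vertex
  v : Fin 7 → Vertex

next : Fin 7 → Fin 7
next zero = suc zero
next (suc zero) = suc (suc zero)
next (suc (suc zero)) = suc (suc (suc zero))
next (suc (suc (suc zero))) = suc (suc (suc (suc zero)))
next (suc (suc (suc (suc zero)))) = suc (suc (suc (suc (suc zero))))
next (suc (suc (suc (suc (suc zero))))) = suc (suc (suc (suc (suc (suc zero)))))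
next (suc (suc (suc (suc (suc (suc zero)))))) = zero

data Edge : Set where
  outer : Fin 7 → Edge
  inner : Fin 7 → Edge
  spoke : Fin 7 → Edge

ends : Edge → Vertex × Vertex
ends (outer i) = u i , u (next i)
ends (inner i) = v i , v (next i)
ends (spoke i) = u i , v i

allEdges : List Edge
allEdges = map outer (allFinL 7) ++ map inner (allFinL 7) ++ map spoke (allFinL 7)

_≟V_ : (x y : Vertex) → Dec (x ≡ y)
u i ≟V u j with i ≟ j
... | yes refl = yes refl
... | no p = no λ { refl → p refl }
u i ≟V v j = no λ ()
v i ≟V u j = no λ ()
v i ≟V v j with i ≟ j
... | yes refl = yes refl
... | no p = no λ { refl → p refl }

incidentB : Vertex → Edge → Bool
incidentB x e = if ⌊ x ≟V proj₁ (ends e) ⌋ then true else ⌊ x ≟V proj₂ (ends e) ⌋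

-- A signature: the set of negative edges, as a characteristic function
Signature : Set
Signature = Edge → Bool

size : Signature → ℕ
size σ = sum (map (λ e → if σ e then 1 else 0) allEdges)

ShareVertex : Edge → Edge → Set
ShareVertex e f =
  proj₁ (ends e) ≡ proj₁ (ends f) Data.Sum.⊎ (proj₁ (ends e) ≡ proj₂ (ends f)
  Data.Sum.⊎ (proj₂ (ends e) ≡ proj₁ (ends f) Data.Sum.⊎ proj₂ (ends e) ≡ proj₂ (ends f)))
  where import Data.Sum

IsMatching : Signature → Set
IsMatching σ = ∀ e f → σ e ≡ true → σ f ≡ true → e ≢ f → ¬ ShareVertex e f

resign : Vertex → Signature → Signature
resign x σ e = σ e xor incidentB x e

ResignStep : Signature → Signature → Set
ResignStep σ τ = Data.Product.Σ Vertex (λ x → ∀ e → τ e ≡ resign x σ e)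
  where import Data.Product

SwitchEquiv : Signature → Signature → Set
SwitchEquiv = Star ResignStep

{-# OPTIONS --safe #-}
-- Resigning at the vertices of a set X replaces Σ by Σ Δ δ(X), where δ(X) is the edge cut of X.
-- Eight sets X, up to the 28 symmetries of P(7,1), suffice: for each of the 1085 matchings M of
-- size five, M Δ δ(X) is a matching of size at most 4 for some image X of one of them.  This is
-- checked by evaluation, on signatures coded by their lists of values along allEdges.
module Submission where

open import Defs
open import Data.Bool using (Bool; true; false; if_then_else_; _xor_)
open import Data.Bool.Properties using (xor-assoc; xor-identityʳ)
open import Data.Fin using (opposite; #_)
open import Data.List using (List; []; _∷_; _++_; map; foldr; filter; concatMap; zipWith;
  iterate; allFin)
open import Data.List.Membership.Propositional using (_∈_)
open import Data.List.Membership.Propositional.Properties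
  using (∈-++⁺ˡ; ∈-++⁺ʳ; ∈-map⁺; ∈-filter⁺; ∈-allFin)
open import Data.List.Relation.Unary.All as All using (All; []; _∷_; all?)
open import Data.List.Relation.Unary.AllPairs as AllPairs using (AllPairs; []; _∷_; allPairs?)
open import Data.List.Relation.Unary.Any as Any using (Any; here; there; any?)
import Data.List.Relation.Unary.Any.Properties as Any
open import Data.List.Relation.Unary.Unique.Propositional using (Unique)
open import Data.Nat using (ℕ; _≤_; _≤?_)
import Data.Nat.Properties as ℕ
open import Data.Nat.ListAction using (sum)
open import Data.Product using (Σ; _×_; _,_; proj₁; proj₂)
open import Data.Product.Properties using (≡-dec)
open import Data.Sum using (inj₁; inj₂)
open import Function using (_∘_; id)
open import Relation.Binary.Construct.Closure.ReflexiveTransitive using (ε; _◅◅_; _◅_)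
open import Relation.Binary.Definitions using (Symmetric)
open import Relation.Binary.PropositionalEquality
  using (_≡_; _≢_; refl; sym; trans; cong; cong₂; subst)
open import Relation.Nullary using (¬_; Dec; contradiction)
open import Relation.Nullary.Decidable using (¬?; _×-dec_; _⊎-dec_; _→-dec_; toWitness)

NonAdjacent : Edge → Edge → Set
NonAdjacent e f = ¬ ShareVertex e f

nonAdjacent? : ∀ e f → Dec (NonAdjacent e f)
nonAdjacent? e f = ¬?
  ((proj₁ (ends e) ≟V proj₁ (ends f)) ⊎-dec ((proj₁ (ends e) ≟V proj₂ (ends f))
    ⊎-dec ((proj₂ (ends e) ≟V proj₁ (ends f)) ⊎-dec (proj₂ (ends e) ≟V proj₂ (ends f)))))

nonAdjacent-sym : ∀ e f → NonAdjacent e f → NonAdjacent f e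
nonAdjacent-sym _ _ e∦f (inj₁ p)               = e∦f (inj₁ (sym p))
nonAdjacent-sym _ _ e∦f (inj₂ (inj₁ p))        = e∦f (inj₂ (inj₂ (inj₁ (sym p))))
nonAdjacent-sym _ _ e∦f (inj₂ (inj₂ (inj₁ p))) = e∦f (inj₂ (inj₁ (sym p)))
nonAdjacent-sym _ _ e∦f (inj₂ (inj₂ (inj₂ p))) = e∦f (inj₂ (inj₂ (inj₂ (sym p))))

∈-allEdges : ∀ e → e ∈ allEdges
∈-allEdges (outer i) = ∈-++⁺ˡ (∈-map⁺ outer (∈-allFin i))
∈-allEdges (inner i) =
  ∈-++⁺ʳ (map outer (allFin 7)) (∈-++⁺ˡ (∈-map⁺ inner (∈-allFin i)))
∈-allEdges (spoke i) =
  ∈-++⁺ʳ (map outer (allFin 7)) (∈-++⁺ʳ (map inner (allFin 7)) (∈-map⁺ spoke (∈-allFin i)))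

-- Distinct edges already differ in their ordered pairs of ends, so the decision procedure `_≟V_` on
-- vertices is enough.
allEdges-unique : Unique allEdges
allEdges-unique = AllPairs.map (_∘ cong ends)
  (toWitness {a? = allPairs? (λ e f → ¬? (≡-dec _≟V_ _≟V_ (ends e) (ends f))) allEdges} _)

select : ∀ {A : Set} → List Bool → List A → List A
select (true  ∷ bs) (x ∷ xs) = x ∷ select bs xs
select (false ∷ bs) (x ∷ xs) = select bs xs
select _            _        = []

∈-select⁺ : ∀ {A : Set} (p : A → Bool) {x xs} → x ∈ xs → p x ≡ true → x ∈ select (map p xs) xs
∈-select⁺ p (here refl) px rewrite px = here refl
∈-select⁺ p {xs = y ∷ _} (there x∈xs) px with p y
... | true  = there (∈-select⁺ p x∈xs px)
... | false = ∈-select⁺ p x∈xs px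

All-select⁺ : ∀ {A : Set} {Q : A → Set} (p : A → Bool) {xs} →
  All (λ x → p x ≡ true → Q x) xs → All Q (select (map p xs) xs)
All-select⁺ p []               = []
All-select⁺ p {x ∷ _} (q ∷ qs) with p x
... | true  = q refl ∷ All-select⁺ p qs
... | false = All-select⁺ p qs

-- `AllPairs` relates an entry only to later ones; symmetry covers the other order.
AllPairs-lookup : ∀ {A : Set} {R : A → A → Set} → Symmetric R → ∀ {x y xs} →
  AllPairs R xs → x ∈ xs → y ∈ xs → x ≢ y → R x y
AllPairs-lookup R-sym (_  ∷ _)   (here refl) (here refl) x≢y = contradiction refl x≢y
AllPairs-lookup R-sym (rs ∷ _)   (here refl) (there y∈)  x≢y = All.lookup rs y∈
AllPairs-lookup R-sym (rs ∷ _)   (there x∈)  (here refl) x≢y = R-sym (All.lookup rs x∈)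
AllPairs-lookup R-sym (_  ∷ rss) (there x∈)  (there y∈)  x≢y = AllPairs-lookup R-sym rss x∈ y∈ x≢y

-- Separate from matchings so that the recursive value, used twice, is evaluated only once.
extend : Edge → List Edge → List (List Bool) → List (List Bool)
extend e es bss =
  map (false ∷_) bss ++ map (true ∷_) (filter (λ bs → all? (nonAdjacent? e) (select bs es)) bss)

-- Conflicting choices are dropped as each edge is added, so the evaluation never lists all 2^21
-- edge sets.
matchings : List Edge → List (List Bool)
matchings []       = [] ∷ []
matchings (e ∷ es) = extend e es (matchings es)

-- `IsMatching` constrains distinct edges only; uniqueness of `es` makes the head differ from every
-- later edge, so the filter in `extend` keeps the coded tail.
∈-matchings : ∀ σ → IsMatching σ → ∀ {es} → Unique es → map σ es ∈ matchings es
∈-matchings σ σ-matching []                       = here refl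
∈-matchings σ σ-matching {e ∷ es} (e∉es ∷ es-unique) with σ e in σe
... | false = ∈-++⁺ˡ (∈-map⁺ (false ∷_) (∈-matchings σ σ-matching es-unique))
... | true  = ∈-++⁺ʳ (map (false ∷_) (matchings es)) (∈-map⁺ (true ∷_)
  (∈-filter⁺ (λ bs → all? (nonAdjacent? e) (select bs es)) (∈-matchings σ σ-matching es-unique)
    (All-select⁺ σ (All.map (λ {f} e≢f σf → σ-matching e f σe σf e≢f) e∉es))))

weight : List Bool → ℕ
weight bs = sum (map (λ b → if b then 1 else 0) bs)

SmallMatching : List Bool → Set
SmallMatching bs = weight bs ≤ 4 × AllPairs NonAdjacent (select bs allEdges)

smallMatching? : ∀ bs → Dec (SmallMatching bs)
smallMatching? bs = (weight bs ≤? 4) ×-dec allPairs? nonAdjacent? (select bs allEdges)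

-- The bound transfers as it is: `allEdges` is a closed list, so `size τ` and
-- `weight (map τ allEdges)` compute to the same sum.
smallMatching-sound : ∀ τ → SmallMatching (map τ allEdges) → IsMatching τ × size τ ≤ 4
smallMatching-sound τ (≤4 , pairs) =
  (λ e f τe τf → AllPairs-lookup (λ {e} {f} → nonAdjacent-sym e f) pairs
    (∈-select⁺ τ (∈-allEdges e) τe) (∈-select⁺ τ (∈-allEdges f) τf)) , ≤4

-- For `xs` without repetitions this is the edge cut of `xs`: an edge with both ends in `xs` is
-- flipped twice.
cut : List Vertex → Signature
cut xs = foldr resign (λ _ → false) xs

cutValues : List Vertex → List Bool
cutValues xs = map (cut xs) allEdges

resignAll : List Vertex → Signature → Signature
resignAll xs σ = foldr resign σ xs

resignAll-switchEquiv : ∀ xs σ → SwitchEquiv σ (resignAll xs σ)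
resignAll-switchEquiv []       σ = ε
-- `foldr` resigns at the head last, so its step closes the chain.
resignAll-switchEquiv (x ∷ xs) σ = resignAll-switchEquiv xs σ ◅◅ ((x , λ _ → refl) ◅ ε)

-- By associativity of xor the resignings gather into one vector that does not depend on `σ`, so the
-- cuts can be tabulated once.
resignAll-cut : ∀ xs σ e → σ e xor cut xs e ≡ resignAll xs σ e
resignAll-cut []       σ e = xor-identityʳ (σ e)
resignAll-cut (x ∷ xs) σ e = trans (sym (xor-assoc (σ e) (cut xs e) (incidentB x e)))
  (cong (_xor incidentB x e) (resignAll-cut xs σ e))

zipWith-map-diag : ∀ {A B C D : Set} (_⊕_ : B → C → D) (f : A → B) (g : A → C) {h : A → D} →
  (∀ x → f x ⊕ g x ≡ h x) → ∀ xs → zipWith _⊕_ (map f xs) (map g xs) ≡ map h xs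
zipWith-map-diag _⊕_ f g eq []       = refl
zipWith-map-diag _⊕_ f g eq (x ∷ xs) = cong₂ _∷_ (eq x) (zipWith-map-diag _⊕_ f g eq xs)

rotate reflect swap : Vertex → Vertex
rotate  (u i) = u (next i)
rotate  (v i) = v (next i)
reflect (u i) = u (opposite i)
reflect (v i) = v (opposite i)
swap    (u i) = v i
swap    (v i) = u i

-- The four maps represent the cosets of the rotation group in the symmetry group of order 28; seven
-- rotations of each give every symmetry.
images : List Vertex → List (List Vertex)
images xs = concatMap (λ f → iterate (map rotate) (map f xs) 7)
  (id ∷ reflect ∷ swap ∷ reflect ∘ swap ∷ [])

-- Found by a greedy set cover over the 5-matchings, most effective set first.
switchingSets : List (List Vertex)
switchingSets = concatMap images
  ( (u (# 0) ∷ u (# 1) ∷ v (# 0) ∷ [])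
  ∷ (u (# 0) ∷ u (# 1) ∷ u (# 2) ∷ [])
  ∷ (u (# 0) ∷ u (# 1) ∷ v (# 0) ∷ v (# 1) ∷ [])
  ∷ (u (# 0) ∷ u (# 1) ∷ u (# 2) ∷ u (# 3) ∷ v (# 0) ∷ [])
  ∷ (u (# 0) ∷ u (# 1) ∷ u (# 2) ∷ u (# 3) ∷ u (# 4) ∷ v (# 0) ∷ [])
  ∷ (u (# 0) ∷ u (# 1) ∷ u (# 2) ∷ v (# 0) ∷ v (# 1) ∷ [])
  ∷ (u (# 0) ∷ u (# 1) ∷ u (# 2) ∷ u (# 3) ∷ u (# 4) ∷ u (# 5) ∷ u (# 6) ∷ [])
  ∷ (u (# 0) ∷ u (# 1) ∷ u (# 2) ∷ v (# 0) ∷ v (# 1) ∷ v (# 2) ∷ [])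
  ∷ [])

Reducible : List (List Bool) → List Bool → Set
Reducible cuts bs = weight bs ≡ 5 → Any (λ ds → SmallMatching (zipWith _xor_ bs ds)) cuts

-- Taking the cuts as an argument lets the evaluation share them between all matchings.
allReducible? : ∀ cuts bss → Dec (All (Reducible cuts) bss)
allReducible? cuts = all? λ bs →
  (weight bs ℕ.≟ 5) →-dec any? (λ ds → smallMatching? (zipWith _xor_ bs ds)) cuts

matchings-reducible : All (Reducible (map cutValues switchingSets)) (matchings allEdges)
-- The last `_` has unit type once the decision evaluates to `yes`; this is the whole finite check.
matchings-reducible = toWitness {a? = allReducible? _ (matchings allEdges)} _

reducible-sound : ∀ σ xss → Reducible (map cutValues xss) (map σ allEdges) → size σ ≡ 5 →
  Σ Signature (λ τ → SwitchEquiv σ τ × IsMatching τ × size τ ≤ 4)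
reducible-sound σ xss reducible |σ|≡5 =
  let xs , small = Any.satisfied (Any.map⁻ {f = cutValues} {xs = xss} (reducible |σ|≡5))
      τ          = resignAll xs σ
  in  τ , resignAll-switchEquiv xs σ , smallMatching-sound τ
        -- The check concerns values xored with those of a cut; these are the values of `τ` along
        -- `allEdges`.
        (subst SmallMatching
          (zipWith-map-diag _xor_ σ (cut xs) (resignAll-cut xs σ) allEdges) small)

theorem8 : (σ : Signature) → IsMatching σ → size σ ≡ 5 →
    Σ Signature (λ τ → SwitchEquiv σ τ × IsMatching τ × size τ ≤ 4)
theorem8 σ σ-matching = reducible-sound σ switchingSets
  (All.lookup matchings-reducible (∈-matchings σ σ-matching allEdges-unique))
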